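{- For all integers $m\ge t\ge 0$, the number of $(102,000)$-avoiding inversion sequences $e$ (of any length) with $\operatorname{dist}(e)=m$ and $\operatorname{rank}(e)=t$ equals $$\frac{3t+1}{3m+1}\binom{4m-t}{m-t}.$$ In particular, the number of $(102,000)$-avoiding inversion sequences $e$ with $\operatorname{dist}(e)=m$ and $\operatorname{rank}(e)=0$ is the $3$-Fuss–Catalan number $\frac{1}{3m+1}\binom{4m}{m}$.
   Context: An inversion sequence of length $n$ is an integer sequence $e=(e_1,\dots,e_n)$ with $0\le e_j\le j-1$ for all $j$. It is $(102,000)$-avoiding if there are no indices $i<j<k$ with $e_j<e_i<e_k$ and no indices $i<j<k$ with $e_i=e_j=e_k$. $\operatorname{dist}(e)$ is the number of distinct entries of $e$ (such $e$ has length between $m$ and $2m$ when $\operatorname{dist}(e)=m$). For such $e$ of length $n\ge1$, let $p$ be the least index with $e_1\le\dots\le e_p>e_{p+1}$, with the convention $e_{n+1}=-1$, and set $\operatorname{rank}(e):=(p-1)-e_p$. By convention the empty sequence (length $0$) is included, with $\operatorname{dist}=\operatorname{rank}=0$. -}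

module Defs where

open import Data.Nat using (ℕ; zero; suc; _+_; _∸_; _≤_; _<_)
open import Data.Integer as ℤ using (ℤ; +_; _-_)
open import Data.Fin using (Fin; toℕ; _<_)
open import Data.List using (List; []; _∷_; length; lookup)
open import Data.List.Relation.Unary.AllPairs using (AllPairs)
open import Data.List.Relation.Unary.Unique.Propositional using (Unique)
open import Data.List.Membership.Propositional using (_∈_)
open import Data.Product using (Σ; _×_; _,_)
open import Relation.Nullary using (¬_)
open import Relation.Binary.PropositionalEquality using (_≡_)
open import Relation.Nullary using (yes; no)
open import Data.Nat using (_≟_; _≤?_)
open import Data.List.Membership.DecPropositional _≟_ using (_∈?_)

-- A finite sequence e = (e_1,...,e_n) is a list; list position i : Fin n
-- (0-based) holds e_{i+1}.

IsInvSeq : List ℕ → Set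
IsInvSeq e = (i : Fin (length e)) → lookup e i Data.Nat.≤ toℕ i

Avoids102-000 : List ℕ → Set
Avoids102-000 e =
  (i j k : Fin (length e)) → i Data.Fin.< j → j Data.Fin.< k →
    ¬ (lookup e j Data.Nat.< lookup e i × lookup e i Data.Nat.< lookup e k)
    × ¬ (lookup e i ≡ lookup e j × lookup e j ≡ lookup e k)

dedup-count : List ℕ → ℕ
dedup-count [] = 0
dedup-count (x ∷ xs) with x ∈? xs
... | yes _ = dedup-count xs
... | no  _ = suc (dedup-count xs)

dist : List ℕ → ℕ
dist = dedup-count

-- rank. For e of length n ≥ 1, p is the least index with
-- e_1 ≤ ... ≤ e_p > e_{p+1} (convention e_{n+1} = -1), i.e. p is the length of the
-- longest weakly increasing prefix, and rank = (p - 1) - e_p.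
-- Helper: given the previous entry `prev` at (1-based) position `pos`, walk on.
rankFrom : ℕ → ℕ → List ℕ → ℤ
rankFrom pos prev [] = (+ pos - + 1) - + prev
rankFrom pos prev (x ∷ xs) with prev ≤? x
... | yes _ = rankFrom (suc pos) x xs
... | no  _ = (+ pos - + 1) - + prev

rank : List ℕ → ℤ
rank [] = + 0
rank (x ∷ xs) = rankFrom 1 x xs

{-# OPTIONS --safe #-}
-- Deleting the largest value M of a sequence e gives a bijection that lowers dist by one.  By
-- 102-avoidance everything before the last M is weakly increasing once M is removed, so e is
-- recovered from the remaining sequence e′ and three numbers (a, b, c): M exceeds max e′ by
-- a + 1, the last M is inserted c places before the end of the climbing prefix of e′, and b says
-- whether and where the other M is.  A triple is admissible exactly when a + b + c + t ≡ rank e′ + 1,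
-- where t = rank e and b ≥ 1 if t = 0.  With C = x B³ and B = 1 + x B⁴ this says that the sequences
-- of rank t have generating function Cᵗ B = xᵗ B³ᵗ⁺¹, whose coefficients are Raney numbers.
module Submission where

open import Defs
open import Data.Nat using (ℕ; zero; suc; 2+; pred; _+_; _*_; _∸_; _≤_; _<_;
  z≤n; s≤s; z<s; s<s; _<?_; _≤?_; _≟_)
open import Data.Nat.Combinatorics using (_C_; nCk+nC[k+1]≡[n+1]C[k+1]; nC1≡n; k>n⇒nCk≡0)
open import Data.Nat.Properties
open import Data.Nat.Tactic.RingSolver using (solve-∀)
open import Data.Integer as ℤ using (+_)
import Data.Integer.Properties as ℤ
open import Data.Fin as Fin using (Fin; zero; suc; toℕ)
open import Data.List using (List; []; _∷_; map; _++_; length; lookup; _ʳ++_; reverse; take; drop; filter)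
open import Data.List.Properties using (length-map; length-++; length-ʳ++; length-reverse;
  length-drop; length-take; ʳ++-ʳ++; ++-ʳ++; ʳ++-defn; ++-identityʳ; take++drop≡id; reverse-involutive; ∷-injective;
  filter-all; filter-accept; filter-reject; filter-++)
open import Data.List.Membership.DecPropositional _≟_ using (_∈?_)
open import Data.List.Membership.Propositional using (_∈_; _∉_)
open import Data.List.Membership.Propositional.Properties using (∈-map⁺; ∈-map⁻; ∈-++⁺ˡ; ∈-++⁺ʳ; ∈-++⁻;
  ∈-filter⁺; ∈-filter⁻; ∈-∃++; ∈-lookup)
open import Data.List.Relation.Binary.Sublist.Propositional using (_⊆_; []; _∷_; _∷ʳ_; minimum;
  from∈; to∈; ⊆-refl; ⊆-trans)
  renaming (lookup to ⊆-lookup)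
open import Data.List.Relation.Binary.Sublist.Propositional.Properties as Sub
  using (∷⁻; filter⁺; ʳ++⁺; All-resp-⊆)
open import Data.List.Relation.Unary.All as All using (All; []; _∷_)
open import Data.List.Relation.Unary.All.Properties using (drop⁺; take⁺; ++⁻ˡ; ++⁻ʳ)
  renaming (map⁺ to All-map⁺; ++⁺ to All-++⁺)
open import Data.List.Relation.Unary.AllPairs using ([]; _∷_)
open import Data.List.Relation.Unary.Any using (here; there)
open import Data.List.Relation.Unary.Unique.Propositional using (Unique)
open import Data.List.Relation.Unary.Unique.Propositional.Properties using () renaming (++⁺ to Unique-++⁺)
open import Data.Product using (Σ; ∃; _×_; _,_; proj₁; proj₂)
open import Data.Sum using (_⊎_; inj₁; inj₂; [_,_]′)
open import Data.Unit using (⊤; tt)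
open import Data.Vec as Vec using (Vec; []; _∷_)
open import Function.Base using (_∘_)
open import Function.Bundles using (_⇔_; mk⇔; module Equivalence)
open import Relation.Binary.PropositionalEquality
open import Relation.Nullary using (¬_; yes; no; contradiction)
open import Relation.Unary using (Decidable)
open Equivalence using (to; from)

-- Raney numbers

pascal : ∀ n k → suc n C suc k ≡ n C k + n C suc k
pascal n k = sym (nCk+nC[k+1]≡[n+1]C[k+1] n k)

-- This is (k + 1) C(n, k + 1) = (n - k) C(n, k) with the subtraction moved to the left. Pascal's
-- rule reduces it to two instances for n - 1.
absorption : ∀ n k → suc k * (n C suc k) + k * (n C k) ≡ n * (n C k)
absorption zero zero = refl
absorption zero (suc k)
  rewrite k>n⇒nCk≡0 {0} {suc (suc k)} z<s | k>n⇒nCk≡0 {0} {suc k} z<s = lem k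
  where
  lem : ∀ k → suc (suc k) * 0 + suc k * 0 ≡ 0
  lem = solve-∀
absorption (suc n) zero = trans (+-identityʳ _)
  (trans (+-identityʳ _) (trans (nC1≡n (suc n)) (sym (*-identityʳ (suc n)))))
absorption (suc n) (suc k)
  rewrite pascal n (suc k) | pascal n k = begin
    (2 + k) * (y + z) + (1 + k) * (x + y)
  ≡⟨ regroup k x y z ⟩
    ((2 + k) * z + (1 + k) * y) + ((1 + k) * y + k * x) + (x + y)
  ≡⟨ cong₂ (λ u v → u + v + (x + y)) (absorption n (suc k)) (absorption n k) ⟩
    n * y + n * x + (x + y)
  ≡⟨ collect n x y ⟩
    suc n * (x + y)
  ∎
  where
  open ≡-Reasoning
  x = n C k
  y = n C suc k
  z = n C suc (suc k)
  regroup : ∀ k x y z → (2 + k) * (y + z) + (1 + k) * (x + y)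
    ≡ ((2 + k) * z + (1 + k) * y) + ((1 + k) * y + k * x) + (x + y)
  regroup = solve-∀
  collect : ∀ n x y → n * y + n * x + (x + y) ≡ suc n * (x + y)
  collect = solve-∀

-- The coefficient of xⁿ in B(x)ʳ, where B = 1 + x B⁴: the recurrence is
-- Bʳ⁺¹ = Bʳ + x Bʳ⁺⁴.
raney : ℕ → ℕ → ℕ
raney zero    _       = 1
raney (suc n) zero    = 0
raney (suc n) (suc r) = raney (suc n) r + raney n (r + 4)

-- The difference C(N, n + 1) - 3 C(N, n) with N = r + 4 n + 3 obeys the recurrence by Pascal's
-- rule, because both recursive terms have top N - 1. At r = 0 it vanishes by `absorption`.
raney-C : ∀ n r → raney (suc n) r + 3 * ((r + 4 * n + 3) C n) ≡ (r + 4 * n + 3) C suc n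
raney-C n zero = *-cancelˡ-≡ _ _ (suc n) (+-cancelʳ-≡ (n * x) _ _ (begin
    suc n * (3 * x) + n * x  ≡⟨ collect n x ⟩
    (4 * n + 3) * x          ≡⟨ absorption (4 * n + 3) n ⟨
    suc n * ((4 * n + 3) C suc n) + n * x ∎))
  where
  open ≡-Reasoning
  x = (4 * n + 3) C n
  collect : ∀ n x → suc n * (3 * x) + n * x ≡ (4 * n + 3) * x
  collect = solve-∀
raney-C zero (suc r) = begin
    raney 1 (suc r) + 3     ≡⟨ cong (_+ 3) (raney-1 (suc r)) ⟩
    suc r + 3               ≡⟨ cong (_+ 3) (+-identityʳ (suc r)) ⟨
    suc r + 0 + 3           ≡⟨ nC1≡n (suc r + 0 + 3) ⟨
    (suc r + 0 + 3) C 1     ∎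
  where
  open ≡-Reasoning
  raney-1 : ∀ r → raney 1 r ≡ r
  raney-1 zero    = refl
  raney-1 (suc r) = trans (cong (_+ 1) (raney-1 r)) (+-comm r 1)
raney-C (suc n) (suc r) = begin
    a + b + 3 * (suc w C suc n) ≡⟨ cong (λ u → a + b + 3 * u) (pascal w n) ⟩
    a + b + 3 * (x + y)        ≡⟨ regroup a b x y ⟩
    (b + 3 * x) + (a + 3 * y)  ≡⟨ cong₂ _+_ ih (raney-C (suc n) r) ⟩
    y + w C suc (suc n)        ≡⟨ pascal w (suc n) ⟨
    suc w C suc (suc n)        ∎
  where
  open ≡-Reasoning
  a = raney (suc (suc n)) r
  b = raney (suc n) (r + 4)
  w = r + 4 * suc n + 3
  x = w C n
  y = w C suc n
  top : ∀ n r → r + 4 + 4 * n + 3 ≡ r + 4 * suc n + 3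
  top = solve-∀
  ih : b + 3 * x ≡ y
  ih = subst (λ u → b + 3 * (u C n) ≡ u C suc n) (top n r) (raney-C n (r + 4))
  regroup : ∀ a b x y → a + b + 3 * (x + y) ≡ (b + 3 * x) + (a + 3 * y)
  regroup = solve-∀

raney-closed : ∀ n t →
  (3 * (n + t) + 1) * raney n (3 * t + 1) ≡ (3 * t + 1) * ((4 * n + 3 * t) C n)
raney-closed zero t = refl
-- The padding is three times the left side of `absorption`; this trades the two binomials for one
-- without subtracting.
raney-closed (suc n) t = +-cancelʳ-≡ (3 * (suc n * y) + 3 * (n * x)) _ _ (begin
    (3 * (suc n + t) + 1) * R + (3 * (suc n * y) + 3 * (n * x))
  ≡⟨ cong (λ u → (3 * (suc n + t) + 1) * R + u) (*-distribˡ-+ 3 (suc n * y) (n * x)) ⟨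
    (3 * (suc n + t) + 1) * R + 3 * (suc n * y + n * x)
  ≡⟨ cong (λ u → (3 * (suc n + t) + 1) * R + 3 * u) (absorption w n) ⟩
    (3 * (suc n + t) + 1) * R + 3 * (w * x)
  ≡⟨ regroup n t R x ⟩
    (3 * (suc n + t) + 1) * (R + 3 * x) + 3 * (n * x)
  ≡⟨ cong (λ u → (3 * (suc n + t) + 1) * u + 3 * (n * x)) eq ⟩
    (3 * (suc n + t) + 1) * y + 3 * (n * x)
  ≡⟨ collect n t x y ⟩
    (3 * t + 1) * y + (3 * (suc n * y) + 3 * (n * x))
  ∎)
  where
  open ≡-Reasoning
  w = 4 * suc n + 3 * t
  R = raney (suc n) (3 * t + 1)
  x = w C n
  y = w C suc n
  top : ∀ n t → 3 * t + 1 + 4 * n + 3 ≡ 4 * suc n + 3 * t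
  top = solve-∀
  eq : R + 3 * x ≡ y
  eq = subst (λ u → R + 3 * (u C n) ≡ u C suc n) (top n t) (raney-C n (3 * t + 1))
  regroup : ∀ n t R x → (3 * (suc n + t) + 1) * R + 3 * ((4 * suc n + 3 * t) * x)
    ≡ (3 * (suc n + t) + 1) * (R + 3 * x) + 3 * (n * x)
  regroup = solve-∀
  collect : ∀ n t x y → (3 * (suc n + t) + 1) * y + 3 * (n * x)
    ≡ (3 * t + 1) * y + (3 * (suc n * y) + 3 * (n * x))
  collect = solve-∀

-- Enumerated predicates

Count : {A : Set} → (A → Set) → ℕ → Set
Count {A} P n = Σ (List A) λ L → Unique L × (∀ x → (x ∈ L) ⇔ P x) × length L ≡ n

module _ {A : Set} where

  count-cong : {P Q : A → Set} {n : ℕ} → (∀ x → P x → Q x) → (∀ x → Q x → P x) → Count P n → Count Q n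
  count-cong f g (L , u , e , l) = L , u , (λ x → mk⇔ (f x ∘ to (e x)) (from (e x) ∘ g x)) , l

  count-∅ : {P : A → Set} → (∀ x → ¬ P x) → Count P 0
  count-∅ ¬P = [] , [] , (λ x → mk⇔ (λ ()) (λ p → contradiction p (¬P x))) , refl

  count-≡ : (a : A) → Count (_≡ a) 1
  count-≡ a = a ∷ [] , [] ∷ [] , (λ x → mk⇔ (λ { (here eq) → eq ; (there ()) }) here) , refl

  count-⊎ : {P Q : A → Set} {m n : ℕ} → (∀ x → P x → ¬ Q x) →
            Count P m → Count Q n → Count (λ x → P x ⊎ Q x) (m + n)
  count-⊎ disj (L , u , e , refl) (M , v , f , refl) =
    L ++ M ,
    Unique-++⁺ u v (λ {x} (p , q) → disj x (to (e x) p) (to (f x) q)) ,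
    (λ x → mk⇔ (λ p → [ inj₁ ∘ to (e x) , inj₂ ∘ to (f x) ]′ (∈-++⁻ L p))
               [ ∈-++⁺ˡ ∘ from (e x) , ∈-++⁺ʳ L ∘ from (f x) ]′) ,
    length-++ L

unique-map : {A B : Set} (f : A → B) (L : List A) →
             (∀ x y → x ∈ L → y ∈ L → f x ≡ f y → x ≡ y) → Unique L → Unique (map f L)
unique-map f [] inj [] = []
unique-map f (x ∷ L) inj (x∉L ∷ u) =
  All-map⁺ (All.tabulate λ {y} y∈L fx≡fy →
    All.lookup x∉L y∈L (inj x y (here refl) (there y∈L) fx≡fy))
  ∷ unique-map f L (λ y z y∈ z∈ → inj y z (there y∈) (there z∈)) u

count-map : {A B : Set} {P : A → Set} {n : ℕ} (f : A → B) →
            (∀ x y → P x → P y → f x ≡ f y → x ≡ y) →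
            Count P n → Count (λ y → ∃ λ x → P x × y ≡ f x) n
count-map f inj (L , u , e , refl) =
  map f L ,
  unique-map f L (λ x y x∈ y∈ → inj x y (to (e x) x∈) (to (e y) y∈)) u ,
  (λ y → mk⇔ (λ y∈ → let (x , x∈ , eq) = ∈-map⁻ f y∈ in x , to (e x) x∈ , eq)
             (λ { (x , p , refl) → ∈-map⁺ f (from (e x) p) })) ,
  length-map f L

module _ {A : Set} (P : ℕ → A → Set) where

  -- If the class of index t has generating function Cᵗ B, then summing over j free slacks divides
  -- it by (1 - C)ʲ, which is multiplication by Bʲ since B = 1 + C B.
  Slack : (j t : ℕ) → Vec ℕ j × A → Set
  Slack j t (as , x) = P (Vec.sum as + t) x

  -- The recursion splits on whether the first slack is zero, which is Bʳ⁺¹ = Bʳ + x Bʳ⁺⁴.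
  count-slack : ∀ m → (∀ n t → n + t ≡ m → Count (P t) (raney n (3 * t + 1))) →
                (∀ t x → m < t → ¬ P t x) →
                ∀ j n t → n + t ≡ m → Count (Slack j t) (raney n (j + (3 * t + 1)))
  count-slack m count empty zero n t n+t≡m =
    count-cong (λ { (.[] , x) (_ , p , refl) → p }) (λ { ([] , x) p → x , p , refl })
      (count-map ([] ,_) (λ { x .x _ _ refl → refl }) (count n t n+t≡m))
  count-slack m count empty (suc j) n t n+t≡m =
    count-cong join split
      (subst (Count _) (sym (step n)) (count-⊎ disjoint
        (count-map cons0 (λ { x .x _ _ refl → refl }) (count-slack m count empty j n t n+t≡m))
        (count-map bump (λ { (_ ∷ _ , _) (._ ∷ ._ , ._) _ _ refl → refl }) (tail n n+t≡m))))
    where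
    cons0 : Vec ℕ j × A → Vec ℕ (suc j) × A
    cons0 (as , x) = 0 ∷ as , x
    bump : Vec ℕ (suc j) × A → Vec ℕ (suc j) × A
    bump (a ∷ as , x) = suc a ∷ as , x
    -- For n = 0 the bumped index t + 1 exceeds m, where `P` is empty; hence the value 0.
    tailCount : ℕ → ℕ
    tailCount zero    = 0
    tailCount (suc n) = raney n (suc j + (3 * suc t + 1))
    step : ∀ n → raney n (suc j + (3 * t + 1)) ≡ raney n (j + (3 * t + 1)) + tailCount n
    step zero    = refl
    step (suc n) = cong (λ u → raney (suc n) (j + (3 * t + 1)) + raney n u) (lem j t)
      where
      lem : ∀ j t → j + (3 * t + 1) + 4 ≡ suc j + (3 * suc t + 1)
      lem = solve-∀
    tail : ∀ n → n + t ≡ m → Count (Slack (suc j) (suc t)) (tailCount n)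
    tail zero refl = count-∅ λ { (as , x) p → empty _ x (m≤n+m (suc t) (Vec.sum as)) p }
    tail (suc n) refl = count-slack m count empty (suc j) n (suc t) (+-suc n t)
    join : ∀ y → (∃ λ x → Slack j t x × y ≡ cons0 x) ⊎ (∃ λ x → Slack (suc j) (suc t) x × y ≡ bump x) →
           Slack (suc j) t y
    join _ (inj₁ (_ , p , refl)) = p
    join _ (inj₂ ((a ∷ as , x) , p , refl)) = subst (λ u → P u x) (+-suc _ t) p
    split : ∀ y → Slack (suc j) t y →
      (∃ λ x → Slack j t x × y ≡ cons0 x) ⊎ (∃ λ x → Slack (suc j) (suc t) x × y ≡ bump x)
    split (zero ∷ as , x) p = inj₁ ((as , x) , p , refl)
    split (suc a ∷ as , x) p = inj₂ ((a ∷ as , x) , subst (λ u → P u x) (sym (+-suc _ t)) p , refl)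
    disjoint : ∀ y → (∃ λ x → Slack j t x × y ≡ cons0 x) →
               ¬ (∃ λ x → Slack (suc j) (suc t) x × y ≡ bump x)
    disjoint _ (_ , _ , refl) ((_ ∷ _ , _) , _ , ())

-- Sequences split after their climbing prefix

private variable
  x y M k m t : ℕ
  R S : List ℕ

-- The zipper (R , S) stands for the sequence R ʳ++ S; in a valid one R is its longest weakly
-- increasing prefix, in reverse order.
Zipper : Set
Zipper = List ℕ × List ℕ

unzip : Zipper → List ℕ
unzip (R , S) = R ʳ++ S

-- One more than the last entry of the prefix, so that the empty prefix needs no separate treatment.
bound : List ℕ → ℕ
bound []      = 0
bound (x ∷ _) = suc x

-- The list is reversed, so `length R` is the 0-based position of x and x ≤ `length R` is the
-- inversion condition there.
Climb : List ℕ → Set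
Climb []      = ⊤
Climb (x ∷ R) = bound R ≤ suc x × x ≤ length R × Climb R

-- With N = `bound R` this is a strict descent from the last prefix entry. For the empty prefix N =
-- 0, which forces the rest to be empty too.
Falls : ℕ → List ℕ → Set
Falls N []      = ⊤
Falls N (y ∷ _) = suc y < N

-- Patterns are sublists rather than index triples, so that filtering and reversing a sequence act
-- on them directly.
Avoid : List ℕ → Set
Avoid e = ∀ {x y z} → (x ∷ y ∷ z ∷ []) ⊆ e → ¬ (y < x × x < z) × ¬ (x ≡ y × y ≡ z)

-- `rise` says that the rank is t, since (p - 1) - e_p is `length` minus `bound`. By `below`, the
-- last entry of the prefix is the maximum of the whole sequence; this also gives the inversion
-- condition beyond the prefix.
record Valid (m t : ℕ) (z : Zipper) : Set where
  constructor valid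
  field
    climb : Climb (proj₁ z)
    rise  : length (proj₁ z) ≡ bound (proj₁ z) + t
    below : All (_< bound (proj₁ z)) (proj₂ z)
    falls : Falls (bound (proj₁ z)) (proj₂ z)
    avoid : Avoid (unzip z)
    dist≡ : dist (unzip z) ≡ m
open Valid

-- Reversed concatenation, cutting and sublists

module _ {A : Set} where

  All-ʳ++ : {P : A → Set} {xs ys : List A} → All P xs → All P ys → All P (xs ʳ++ ys)
  All-ʳ++ []       qs = qs
  All-ʳ++ (p ∷ ps) qs = All-ʳ++ ps (p ∷ qs)

  ʳ++-++ : (xs {ys zs} : List A) → (xs ʳ++ ys) ++ zs ≡ xs ʳ++ (ys ++ zs)
  ʳ++-++ []       = refl
  ʳ++-++ (x ∷ xs) = ʳ++-++ xs

  ⊆-ʳ++ʳ : (xs {ys} : List A) → ys ⊆ xs ʳ++ ys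
  ⊆-ʳ++ʳ xs = ʳ++⁺ (minimum xs) ⊆-refl

  drop-ʳ++-take : (k : ℕ) (xs {ys} : List A) → drop k xs ʳ++ (take k xs ʳ++ ys) ≡ xs ʳ++ ys
  drop-ʳ++-take zero    xs       = refl
  drop-ʳ++-take (suc k) []       = refl
  drop-ʳ++-take (suc k) (x ∷ xs) = drop-ʳ++-take k xs

  drop-length-++ : (xs {ys} : List A) → drop (length xs) (xs ++ ys) ≡ ys
  drop-length-++ []       = refl
  drop-length-++ (x ∷ xs) = drop-length-++ xs

  take-length-++ : (xs {ys} : List A) → take (length xs) (xs ++ ys) ≡ xs
  take-length-++ []       = refl
  take-length-++ (x ∷ xs) = cong (x ∷_) (take-length-++ xs)

  drop-ʳ++ : (xs {ys} : List A) → drop (length xs) (xs ʳ++ ys) ≡ ys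
  drop-ʳ++ xs {ys} rewrite ʳ++-defn xs {ys} | sym (length-reverse xs) = drop-length-++ (reverse xs)

  take-ʳ++-ʳ++ : (xs {ys zs} : List A) → take (length xs) (xs ʳ++ ys) ʳ++ zs ≡ xs ++ zs
  take-ʳ++-ʳ++ xs {ys} {zs}
    rewrite ʳ++-defn xs {ys} | sym (length-reverse xs) | take-length-++ (reverse xs) {ys} =
    ʳ++-ʳ++ xs

  ++-∷-injective : {x : A} (xs xs′ : List A) {ys ys′ : List A} → x ∉ xs → x ∉ xs′ →
                   xs ++ x ∷ ys ≡ xs′ ++ x ∷ ys′ → xs ≡ xs′
  ++-∷-injective []       []         p q eq   = refl
  ++-∷-injective []       (x′ ∷ xs′) p q refl = contradiction (here refl) q
  ++-∷-injective (x ∷ xs) []         p q refl = contradiction (here refl) p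
  ++-∷-injective (x ∷ xs) (x′ ∷ xs′) p q eq with refl , eq′ ← ∷-injective eq =
    cong (x ∷_) (++-∷-injective xs xs′ (λ i → p (there i)) (λ i → q (there i)) eq′)

  ⊆-after : {x : A} {ws xs ys : List A} → x ∉ xs → x ∷ ws ⊆ xs ++ x ∷ ys → ws ⊆ ys
  ⊆-after {xs = []}     x∉ p          = ∷⁻ p
  ⊆-after {xs = _ ∷ xs} x∉ (_ ∷ʳ p)   = ⊆-after (λ i → x∉ (there i)) p
  ⊆-after {xs = _ ∷ xs} x∉ (refl ∷ p) = contradiction (here refl) x∉

filter-ʳ++ : {A : Set} {P : A → Set} (P? : Decidable P) (xs : List A) {ys : List A} →
             filter P? (xs ʳ++ ys) ≡ filter P? xs ʳ++ filter P? ys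
filter-ʳ++ P? []       = refl
filter-ʳ++ P? (x ∷ xs) {ys} with ih ← filter-ʳ++ P? xs {x ∷ ys} | P? x
... | yes _ = ih
... | no  _ = ih

-- Climbing prefixes and distinct entries

<⇒∉ : All (_< M) R → M ∉ R
<⇒∉ all i = <-irrefl refl (All.lookup all i)

≤∧∉⇒< : All (_≤ M) R → M ∉ R → All (_< M) R
≤∧∉⇒< all M∉ = All.tabulate λ i → ≤∧≢⇒< (All.lookup all i) λ { refl → M∉ i }

climb-below : ∀ R → Climb R → All (_< bound R) R
climb-below []      _             = []
climb-below (x ∷ R) (p , _ , c) = ≤-refl ∷ All.map (λ q → <-≤-trans q p) (climb-below R c)

climb-drop : ∀ k R → Climb R → Climb (drop k R)
climb-drop zero    R       c           = c
climb-drop (suc k) []      c           = c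
climb-drop (suc k) (x ∷ R) (_ , _ , c) = climb-drop k R c

climb-bound : ∀ R → Climb R → bound R ≤ length R
climb-bound []      _           = z≤n
climb-bound (x ∷ R) (_ , p , _) = s≤s p

climb-desc : ∀ R → Climb R → y ∷ x ∷ [] ⊆ R → x ≤ y
climb-desc (_ ∷ R) (_ , _ , c) (_ ∷ʳ p)   = climb-desc R c p
climb-desc (_ ∷ R) (p , _ , c) (refl ∷ q) =
  ≤-pred (<-≤-trans (All.lookup (climb-below R c) (to∈ q)) p)

bound-≤ : All (_< M) R → bound R ≤ M
bound-≤ []      = z≤n
bound-≤ (p ∷ _) = p

falls-< : All (_< M) S → Falls (suc M) S
falls-< []      = tt
falls-< (p ∷ _) = s≤s p

falls-ʳ++ : ∀ x R → All (_< M) (x ∷ R) → Falls (suc M) ((x ∷ R) ʳ++ S)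
falls-ʳ++ x []      (p ∷ _)  = s≤s p
falls-ʳ++ x (y ∷ R) (p ∷ ps) = falls-ʳ++ y R ps

-- `dist` counts each value at its last occurrence. Smaller values keep theirs in the filtered list,
-- and only the last M is lost.
dist-below : ∀ e → All (_≤ M) e → M ∈ e → dist e ≡ suc (dist (filter (_<? M) e))
dist-below {M} (x ∷ xs) (x≤M ∷ xs≤M) M∈ with m≤n⇒m<n∨m≡n x≤M
dist-below {M} (x ∷ xs) (x≤M ∷ xs≤M) (here refl) | inj₁ x<M = contradiction x<M (<-irrefl refl)
dist-below {M} (x ∷ xs) (x≤M ∷ xs≤M) (there M∈) | inj₁ x<M
  rewrite filter-accept (_<? M) {xs = xs} x<M
  with x ∈? xs | x ∈? filter (_<? M) xs
... | yes _ | yes _ = dist-below xs xs≤M M∈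
... | no _  | no _  = cong suc (dist-below xs xs≤M M∈)
... | yes p | no ¬q = contradiction (∈-filter⁺ (_<? M) p x<M) ¬q
... | no ¬p | yes q = contradiction (proj₁ (∈-filter⁻ (_<? M) q)) ¬p
dist-below {M} (x ∷ xs) (x≤M ∷ xs≤M) M∈ | inj₂ refl
  rewrite filter-reject (_<? x) {xs = xs} (<-irrefl refl) with x ∈? xs
... | yes p = dist-below xs xs≤M p
... | no ¬p = cong suc (cong dist (sym (filter-all (_<? x) (≤∧∉⇒< xs≤M ¬p))))

-- The maximal entry M occurs either twice in a row at the end of the prefix (b = 0), once
-- (b = 1), or twice with b ∸ 1 entries of the remaining sequence in between.
peak : ℕ → ℕ → Zipper → Zipper
peak 0      M (R , S) = M ∷ M ∷ R , S
peak 1      M (R , S) = M ∷ R , S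
peak (2+ d) M (R , S) = M ∷ drop (suc d) R , take (suc d) R ʳ++ (M ∷ S)

-- The entries preceding the last M, in reverse order.
left : ℕ → ℕ → List ℕ → List ℕ
left 0      M R = M ∷ R
left 1      M R = R
left (2+ d) M R = take (suc d) R ++ M ∷ drop (suc d) R

-- Cutting at the last M instead of at the end of the climbing prefix gives the three cases of
-- `peak` a common shape.
peak-left : ∀ b → unzip (peak b M (R , S)) ≡ left b M R ʳ++ (M ∷ S)
peak-left 0      = refl
peak-left 1      = refl
peak-left {R = R} (2+ d) = sym (++-ʳ++ (take (suc d) R))

-- The numbering of b is chosen for this: in all three cases the new prefix has `length R` + 2 - b
-- entries.
peak-length : ∀ b → b ≤ suc (length R) → length (proj₁ (peak b M (R , S))) + b ≡ 2+ (length R)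
peak-length 0 _ = +-identityʳ _
peak-length 1 _ = +-comm _ 1
peak-length {R = R} (2+ d) (s≤s p) rewrite length-drop (suc d) R =
  cong suc (trans (+-suc _ (suc d)) (cong suc (m∸n+n≡m p)))

-- Sequences with a new maximum inserted

module _ {M : ℕ} {R S : List ℕ} (R<M : All (_< M) R) (S<M : All (_< M) S) (b : ℕ) where

  filter-left : ∀ b → filter (_<? M) (left b M R) ≡ R
  filter-left 0 = trans (filter-reject (_<? M) (<-irrefl refl)) (filter-all (_<? M) R<M)
  filter-left 1 = filter-all (_<? M) R<M
  filter-left (2+ d) = begin
    filter (_<? M) (take (suc d) R ++ M ∷ drop (suc d) R)
      ≡⟨ filter-++ (_<? M) (take (suc d) R) _ ⟩
    filter (_<? M) (take (suc d) R) ++ filter (_<? M) (M ∷ drop (suc d) R)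
      ≡⟨ cong₂ _++_ (filter-all (_<? M) (take⁺ (suc d) R<M))
           (trans (filter-reject (_<? M) (<-irrefl refl)) (filter-all (_<? M) (drop⁺ (suc d) R<M))) ⟩
    take (suc d) R ++ drop (suc d) R
      ≡⟨ take++drop≡id (suc d) R ⟩
    R ∎
    where open ≡-Reasoning

  left-once : ∀ b → ¬ (M ∷ M ∷ [] ⊆ left b M R)
  left-once 0      p = <⇒∉ R<M (to∈ (∷⁻ p))
  left-once 1      p = <⇒∉ R<M (to∈ p)
  left-once (2+ d) p = <⇒∉ (drop⁺ (suc d) R<M) (to∈ (⊆-after (<⇒∉ (take⁺ (suc d) R<M)) p))

  left-≤ : ∀ b → All (_≤ M) (left b M R)
  left-≤ 0      = ≤-refl ∷ All.map <⇒≤ R<M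
  left-≤ 1      = All.map <⇒≤ R<M
  left-≤ (2+ d) = All-++⁺ (All.map <⇒≤ (take⁺ (suc d) R<M)) (≤-refl ∷ All.map <⇒≤ (drop⁺ (suc d) R<M))

  peak-≤ : All (_≤ M) (unzip (peak b M (R , S)))
  peak-≤ rewrite peak-left {M} {R} {S} b = All-ʳ++ (left-≤ b) (≤-refl ∷ All.map <⇒≤ S<M)

  peak-∈ : M ∈ unzip (peak b M (R , S))
  peak-∈ rewrite peak-left {M} {R} {S} b = ⊆-lookup (⊆-ʳ++ʳ (left b M R)) (here refl)

  filter-peak : filter (_<? M) (unzip (peak b M (R , S))) ≡ R ʳ++ S
  filter-peak rewrite peak-left {M} {R} {S} b | filter-ʳ++ (_<? M) (left b M R) {M ∷ S} =
    cong₂ _ʳ++_ (filter-left b)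
      (trans (filter-reject (_<? M) (<-irrefl refl)) (filter-all (_<? M) S<M))

  reverse-peak : unzip (peak b M (R , S)) ʳ++ [] ≡ reverse S ++ M ∷ left b M R
  reverse-peak rewrite peak-left {M} {R} {S} b = begin
    (left b M R ʳ++ (M ∷ S)) ʳ++ [] ≡⟨ ʳ++-ʳ++ (left b M R) ⟩
    S ʳ++ (M ∷ left b M R ++ [])    ≡⟨ cong (λ u → S ʳ++ (M ∷ u)) (++-identityʳ _) ⟩
    S ʳ++ (M ∷ left b M R)          ≡⟨ ʳ++-defn S ⟩
    reverse S ++ M ∷ left b M R     ∎
    where open ≡-Reasoning

  dist-peak : dist (unzip (peak b M (R , S))) ≡ suc (dist (R ʳ++ S))
  dist-peak = trans (dist-below _ peak-≤ peak-∈) (cong (λ u → suc (dist u)) filter-peak)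

  -- Read backwards the pattern starts with M, so its other two entries lie behind the first M of
  -- the reversed sequence.
  before-peak : x ∷ y ∷ M ∷ [] ⊆ unzip (peak b M (R , S)) → y ∷ x ∷ [] ⊆ left b M R
  before-peak p = ⊆-after (<⇒∉ (All-ʳ++ S<M [])) (subst (_ ⊆_) reverse-peak (ʳ++⁺ p []))

  ⊆-below : {xs : List ℕ} → All (_< M) xs → xs ⊆ unzip (peak b M (R , S)) → xs ⊆ R ʳ++ S
  ⊆-below xs<M p = subst₂ _⊆_ (filter-all (_<? M) xs<M) filter-peak
    (filter⁺ (_<? M) (_<? M) (λ { refl q → q }) p)

  -- A pattern whose last entry is below M survives the deletion of M. A 102 ending in M would need
  -- a descent in the climbing list `R`, and a 000 of M's would need two copies before the last one.
  peak-avoid : Climb R → Avoid (R ʳ++ S) → Avoid (unzip (peak b M (R , S)))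
  peak-avoid c av {x} {y} {z} p with All-resp-⊆ p peak-≤
  ... | x≤M ∷ y≤M ∷ z≤M ∷ [] = no102 , no000
    where
    no102 : ¬ (y < x × x < z)
    no102 (y<x , x<z) with m≤n⇒m<n∨m≡n z≤M
    ... | inj₁ z<M = proj₁ (av (⊆-below (<-trans x<z z<M ∷ <-trans y<x (<-trans x<z z<M) ∷ z<M ∷ []) p))
          (y<x , x<z)
    ... | inj₂ refl = <⇒≱ y<x (climb-desc R c
      (subst₂ _⊆_ (filter-all (_<? M) (<-trans y<x x<z ∷ x<z ∷ [])) (filter-left b)
        (filter⁺ (_<? M) (_<? M) (λ { refl q → q }) (before-peak p))))
    no000 : ¬ (x ≡ y × y ≡ z)
    no000 (refl , refl) with m≤n⇒m<n∨m≡n z≤M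
    ... | inj₁ z<M = proj₂ (av (⊆-below (z<M ∷ z<M ∷ z<M ∷ []) p)) (refl , refl)
    ... | inj₂ refl = left-once b (before-peak p)

  -- The part after the last M depends only on the sequence and M; in reverse it is the part before
  -- the first M.
  peak-suffix : {b′ : ℕ} {R′ S′ : List ℕ} → All (_< M) S′ →
    unzip (peak b M (R , S)) ≡ left b′ M R′ ʳ++ (M ∷ S′) → S ≡ S′
  peak-suffix {b′} {R′} {S′} S′<M eq = begin
    S                    ≡⟨ reverse-involutive S ⟨
    reverse (reverse S)  ≡⟨ cong reverse (++-∷-injective (reverse S) (reverse S′)
                              (<⇒∉ (All-ʳ++ S<M [])) (<⇒∉ (All-ʳ++ S′<M [])) eq′) ⟩
    reverse (reverse S′) ≡⟨ reverse-involutive S′ ⟩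
    S′ ∎
    where
    open ≡-Reasoning
    eq′ : reverse S ++ M ∷ left b M R ≡ reverse S′ ++ M ∷ (left b′ M R′ ++ [])
    eq′ = trans (sym reverse-peak) (trans (cong (_ʳ++ []) eq)
            (trans (ʳ++-ʳ++ (left b′ M R′)) (ʳ++-defn S′)))

-- Finding the climbing prefix

Capped : ℕ → List ℕ → Set
Capped k []       = ⊤
Capped k (x ∷ xs) = x ≤ k × Capped (suc k) xs

<⇒capped : ∀ S → All (_< M) S → M ≤ suc k → Capped k S
<⇒capped []      []       M≤k = tt
<⇒capped (x ∷ S) (p ∷ ps) M≤k = ≤-pred (≤-trans p M≤k) , <⇒capped S ps (m≤n⇒m≤1+n M≤k)

-- Entries move from `S` to the prefix while it climbs; `T` records them. At the first strict
-- descent, a later entry above the end of the prefix would complete a 102, which yields `below`.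
normalise : ∀ R S → Climb R → Capped (length R) S → Avoid (R ʳ++ S) →
  ∃ λ T → ∃ λ S′ → ∃ λ s → S ≡ T ++ S′ × Valid (dist (R ʳ++ S)) s (T ʳ++ R , S′)
normalise R [] c _ av =
  [] , [] , length R ∸ bound R , refl ,
  valid c (sym (m+[n∸m]≡n (climb-bound R c))) [] tt av refl
normalise R (y ∷ S) c (y≤ , cap) av with bound R ≤? suc y
... | yes p with T , S′ , s , refl , v ← normalise (y ∷ R) S (p , y≤ , c) cap av =
  y ∷ T , S′ , s , refl , v
... | no ¬p =
  [] , y ∷ S , length R ∸ bound R , refl ,
  valid c (sym (m+[n∸m]≡n (climb-bound R c))) (below′ R (≰⇒> ¬p) av) (≰⇒> ¬p) av refl
  where
  below′ : ∀ R → suc y < bound R → Avoid (R ʳ++ (y ∷ S)) → All (_< bound R) (y ∷ S)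
  below′ (x ∷ R) y<x av = <-trans (n<1+n y) y<x ∷ All.tabulate λ z∈ → s≤s (≮⇒≥ λ x<z →
    proj₁ (av (⊆-trans (refl ∷ refl ∷ from∈ z∈) (⊆-ʳ++ʳ R))) (≤-pred y<x , x<z))

split : List ℕ → List ℕ → Zipper
split R []      = R , []
split R (y ∷ S) with bound R ≤? suc y
... | yes _ = split (y ∷ R) S
... | no  _ = R , y ∷ S

split-falls : ∀ R S → Falls (bound R) S → split R S ≡ (R , S)
split-falls R []      _ = refl
split-falls R (y ∷ S) f with bound R ≤? suc y
... | yes p = contradiction p (<⇒≱ f)
... | no  _ = refl

split-climb : ∀ R S → Climb R → split [] (R ʳ++ S) ≡ split R S
split-climb []      S c = refl
split-climb (x ∷ R) S (p , _ , c) with eq ← split-climb R (x ∷ S) c | bound R ≤? suc x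
... | yes _ = eq
... | no ¬p = contradiction p ¬p

-- `split []` recomputes the climbing prefix, so it is a left inverse of `unzip` on valid zippers.
unzip-injective : ∀ {m t m′ t′ z z′} → Valid m t z → Valid m′ t′ z′ → unzip z ≡ unzip z′ → z ≡ z′
unzip-injective v v′ eq = trans (sym (split-valid v)) (trans (cong (split []) eq) (split-valid v′))
  where
  split-valid : ∀ {m t z} → Valid m t z → split [] (unzip z) ≡ z
  split-valid {z = R , S} v = trans (split-climb R S (climb v)) (split-falls R S (falls v))

-- Children of a sequence

shift : ℕ → Zipper → Zipper
shift c (R , S) = drop c R , take c R ʳ++ S

-- `bound` is the least value above every entry, so a = 0 inserts the smallest possible new maximum.
child : ℕ → ℕ → ℕ → Zipper → Zipper
child a b c z = peak b (bound (proj₁ z) + a) (shift c z)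

-- With N the old `bound`, the new prefix has N + s - c + 2 - b entries and new bound N + a + 1; the
-- equation says that they differ by t. For b = 0 the first of the two adjacent M's satisfies the
-- inversion condition only if t ≥ 1.
Admissible : (s t a b c : ℕ) → Set
Admissible s t a b c = a + b + c + t ≡ suc s × (t ≡ 0 → 1 ≤ b)

-- One of b and t is positive, which leaves at most s for c. The bounds ensure that `shift` and
-- `peak` cut within the prefix.
admissible-≤ : ∀ {s t} a b c → Admissible s t a b c → c ≤ s × b + c ≤ suc s
admissible-≤ {s} {t} a b c (eq , pos) = lem b t eq pos , bc
  where
  bc : b + c ≤ suc s
  bc = subst (b + c ≤_) eq (≤-trans (m≤n+m (b + c) a) (≤-trans (≤-reflexive (sym (+-assoc a b c))) (m≤m+n _ t)))
  lem : ∀ b t → a + b + c + t ≡ suc s → (t ≡ 0 → 1 ≤ b) → c ≤ s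
  lem zero    zero    eq pos with () ← pos refl
  lem zero    (suc t) eq pos = ≤-trans (m≤n+m c (a + 0)) (≤-trans (m≤m+n _ t)
    (≤-reflexive (suc-injective (trans (sym (+-suc _ t)) eq))))
  lem (suc b) t       eq pos = ≤-trans (m≤n+m c (a + b)) (≤-trans (m≤m+n _ t)
    (≤-reflexive (suc-injective (trans (cong (λ u → u + c + t) (sym (+-suc a b))) eq))))

module Shift {m s : ℕ} {z : Zipper} (v : Valid m s z) (a c : ℕ) (c≤s : c ≤ s) where
  R′ = proj₁ (shift c z)
  S′ = proj₂ (shift c z)
  N′ = bound (proj₁ z)
  M′ = N′ + a

  c≤length : c ≤ length (proj₁ z)
  c≤length = ≤-trans c≤s (≤-trans (m≤n+m s N′) (≤-reflexive (sym (rise v))))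

  length-R : length R′ + c ≡ N′ + s
  length-R = trans (cong (_+ c) (length-drop c (proj₁ z))) (trans (m∸n+n≡m c≤length) (rise v))

  length-S : length S′ ≡ c + length (proj₂ z)
  length-S = trans (length-ʳ++ (take c (proj₁ z)))
    (cong (_+ length (proj₂ z)) (trans (length-take c (proj₁ z)) (m≤n⇒m⊓n≡m c≤length)))

  unzip-shift : unzip (R′ , S′) ≡ unzip z
  unzip-shift = drop-ʳ++-take c (proj₁ z)

  climb-R : Climb R′
  climb-R = climb-drop c (proj₁ z) (climb v)

  <N⇒<M : ∀ {xs} → All (_< N′) xs → All (_< M′) xs
  <N⇒<M = All.map λ p → <-≤-trans p (m≤m+n N′ a)

  R<M : All (_< M′) R′
  R<M = <N⇒<M (drop⁺ c (climb-below (proj₁ z) (climb v)))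

  S<M : All (_< M′) S′
  S<M = <N⇒<M (All-ʳ++ (take⁺ c (climb-below (proj₁ z) (climb v))) (below v))

child-valid : ∀ {m s t z} a b c → Valid m s z → Admissible s t a b c → Valid (suc m) t (child a b c z)
child-valid {m} {s} {t} {z} a b c v sp@(eq , _) = go b refl
  where
  open Shift v a c (proj₁ (admissible-≤ a b c sp))
  open ≡-Reasoning
  av : Avoid (unzip (R′ , S′))
  av = subst Avoid (sym unzip-shift) (avoid v)
  dist′ : dist (unzip (child a b c z)) ≡ suc m
  dist′ = trans (dist-peak R<M S<M b) (cong suc (trans (cong dist unzip-shift) (dist≡ v)))
  b≤ : b ≤ suc (length R′)
  b≤ = +-cancelʳ-≤ c b (suc (length R′)) (≤-trans (proj₂ (admissible-≤ a b c sp))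
    (s≤s (≤-trans (m≤n+m s N′) (≤-reflexive (sym length-R)))))
  rise′ : length (proj₁ (peak b M′ (R′ , S′))) ≡ suc (M′ + t)
  rise′ = +-cancelʳ-≡ (b + c) _ _ (begin
    length (proj₁ (peak b M′ (R′ , S′))) + (b + c) ≡⟨ +-assoc _ b c ⟨
    length (proj₁ (peak b M′ (R′ , S′))) + b + c   ≡⟨ cong (_+ c) (peak-length b b≤) ⟩
    2+ (length R′ + c)                           ≡⟨ cong 2+ length-R ⟩
    2+ (N′ + s)                                  ≡⟨ cong suc (+-suc N′ s) ⟨
    suc (N′ + suc s)                             ≡⟨ cong (λ u → suc (N′ + u)) eq ⟨
    suc (N′ + (a + b + c + t))                   ≡⟨ regroup N′ a b c t ⟩
    suc (M′ + t) + (b + c)                       ∎)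
    where
    regroup : ∀ N a b c t → suc (N + (a + b + c + t)) ≡ suc (N + a + t) + (b + c)
    regroup = solve-∀
  M≤ : ∀ {k} → suc k ≡ suc (M′ + t) → M′ ≤ k
  M≤ eq = subst (M′ ≤_) (sym (suc-injective eq)) (m≤m+n M′ t)
  go : ∀ b′ → b ≡ b′ → Valid (suc m) t (child a b c z)
  go 0 refl = valid
    (≤-refl , M≤ rise′ , m≤n⇒m≤1+n (bound-≤ R<M) , M≤R , climb-R)
    rise′ (All.map m<n⇒m<1+n S<M) (falls-< S<M) (peak-avoid R<M S<M 0 climb-R av) dist′
    where
    -- With t = 0 the first M would stand one position too early.
    M≤R : M′ ≤ length R′
    M≤R = ≤-pred (subst (M′ <_) (sym (suc-injective rise′))
      (m<m+n M′ (n≢0⇒n>0 λ t≡0 → contradiction (proj₂ sp t≡0) λ ())))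
  go 1 refl = valid
    (m≤n⇒m≤1+n (bound-≤ R<M) , M≤ rise′ , climb-R)
    rise′ (All.map m<n⇒m<1+n S<M) (falls-< S<M) (peak-avoid R<M S<M 1 climb-R av) dist′
  go (2+ d) refl = valid
    (m≤n⇒m≤1+n (bound-≤ (drop⁺ (suc d) R<M)) , M≤ rise′ , climb-drop (suc d) R′ climb-R)
    rise′ (All-ʳ++ (All.map m<n⇒m<1+n (take⁺ (suc d) R<M)) (≤-refl ∷ All.map m<n⇒m<1+n S<M))
    (falls-take R′ R<M b≤)
    (peak-avoid R<M S<M (2+ d) climb-R av) dist′
    where
    -- At least one smaller entry separates the two copies of M, so the climbing prefix ends at the
    -- first copy.
    falls-take : ∀ R′ → All (_< M′) R′ → 2+ d ≤ suc (length R′) → Falls (suc M′) (take (suc d) R′ ʳ++ (M′ ∷ S′))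
    falls-take (x ∷ R′) (p ∷ ps) _ = falls-ʳ++ x (take d R′) (p ∷ take⁺ d ps)
    falls-take [] _ (s≤s ())

-- Deleting the maximum

record Unpeaked (t : ℕ) (z : Zipper) : Set where
  constructor unpeaked
  field
    {b₀ M₀} : ℕ
    {R₀ S₀} : List ℕ
    z≡    : z ≡ peak b₀ M₀ (R₀ , S₀)
    climb₀ : Climb R₀
    R₀<M  : All (_< M₀) R₀
    S₀<M  : All (_< M₀) S₀
    b≤    : b₀ ≤ suc (length R₀)
    M≤    : M₀ ≤ suc (length R₀)
    b>0   : t ≡ 0 → 1 ≤ b₀

climb-ʳ++ : ∀ T R → Climb R → All (_< M) T → M ≤ length R →
            (∀ {x y} → x ∷ y ∷ [] ⊆ R ʳ++ T → x ≤ y) → Climb (T ʳ++ R)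
climb-ʳ++ []      R c []       M≤ asc = c
climb-ʳ++ (y ∷ T) R c (p ∷ ps) M≤ asc =
  climb-ʳ++ T (y ∷ R) (bound≤ R asc , <⇒≤ (<-≤-trans p M≤) , c) ps (m≤n⇒m≤1+n M≤) asc
  where
  bound≤ : ∀ R → (∀ {u w} → u ∷ w ∷ [] ⊆ R ʳ++ (y ∷ T) → u ≤ w) → bound R ≤ suc y
  bound≤ []      _   = z≤n
  bound≤ (x ∷ R) asc = s≤s (asc (⊆-trans (refl ∷ refl ∷ minimum T) (⊆-ʳ++ʳ R)))

-- The top M of the prefix is the maximum, and 000-avoidance allows one further copy. In the prefix
-- it must be adjacent, as the prefix climbs. Beyond the prefix, the entries `T` between the copies
-- continue the climb. The cut is made at the last M, so `R₀` may be shorter than the full climbing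
-- prefix of what remains.
unpeak : ∀ z → Valid (suc m) t z → Unpeaked t z
unpeak ([] , []) v with () ← dist≡ v
unpeak ([] , _ ∷ _) v with () ← falls v
unpeak {t = t} (M ∷ K , S) v with climb v | M ∈? K | M ∈? S
... | p , q , c | no M∉K | no M∉S = unpeaked {b₀ = 1} refl c
  (≤∧∉⇒< (All.map (λ i → ≤-pred (<-≤-trans i p)) (climb-below K c)) M∉K)
  (≤∧∉⇒< (All.map ≤-pred (below v)) M∉S)
  (s≤s z≤n) (m≤n⇒m≤1+n q) (λ _ → ≤-refl)
... | p , q , c | yes M∈K | _ = twice K p q c M∈K v
  where
  twice : ∀ K → bound K ≤ suc M → M ≤ length K → Climb K → M ∈ K →
          Valid (suc _) t (M ∷ K , S) → Unpeaked t (M ∷ K , S)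
  twice (x ∷ R) p q c@(r , r′ , c′) M∈K v
    with refl ← ≤-antisym (≤-pred p) (≤-pred (All.lookup (climb-below (x ∷ R) c) M∈K)) =
    unpeaked {b₀ = 0} refl c′
      (≤∧∉⇒< (All.map (λ i → ≤-pred (<-≤-trans i r)) (climb-below R c′)) M∉R)
      (≤∧∉⇒< (All.map ≤-pred (below v)) M∉S)
      z≤n q (λ { refl → contradiction
        (≤-reflexive (trans (suc-injective (rise v)) (+-identityʳ M))) (<⇒≱ (s≤s r′)) })
    where
    M∉R : M ∉ R
    M∉R i = proj₂ (avoid v (ʳ++⁺ {as = M ∷ M ∷ M ∷ []} (refl ∷ refl ∷ from∈ i) (minimum S))) (refl , refl)
    M∉S : M ∉ S
    M∉S i = proj₂ (avoid v (ʳ++⁺ {as = M ∷ M ∷ []} (refl ∷ refl ∷ minimum R) (from∈ i))) (refl , refl)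
... | p , q , c | no M∉K | yes M∈S with ∈-∃++ M∈S
-- The prefix is followed by a strict descent, so a second M cannot come next.
... | [] , _ , refl = contradiction (falls v) (<-irrefl refl)
... | T@(y ∷ T′) , S′ , refl = unpeaked {b₀ = 2+ (length T′)} {R₀ = T ʳ++ K}
  (cong₂ _,_ (cong (M ∷_) (sym (drop-ʳ++ T))) (sym (take-ʳ++-ʳ++ T)))
  (climb-ʳ++ T K c T<M q asc)
  (All-ʳ++ T<M K<M)
  (≤∧∉⇒< (All.tail (++⁻ʳ T S≤M)) M∉S′)
  (s≤s (≤-trans (m≤m+n (length T) (length K)) (≤-reflexive (sym (length-ʳ++ T)))))
  (m≤n⇒m≤1+n (≤-trans q (≤-trans (m≤n+m (length K) (length T)) (≤-reflexive (sym (length-ʳ++ T))))))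
  (λ _ → s≤s z≤n)
  where
  S≤M : All (_≤ M) (T ++ M ∷ S′)
  S≤M = All.map ≤-pred (below v)
  M∉T : M ∉ T
  M∉T i = proj₂ (avoid v (⊆-trans (refl ∷ Sub.++⁺ (from∈ i) (refl ∷ minimum S′)) (⊆-ʳ++ʳ K))) (refl , refl)
  M∉S′ : M ∉ S′
  M∉S′ i = proj₂ (avoid v (⊆-trans (refl ∷ Sub.++⁺ (minimum T) (refl ∷ from∈ i)) (⊆-ʳ++ʳ K))) (refl , refl)
  T<M : All (_< M) T
  T<M = ≤∧∉⇒< (++⁻ˡ T S≤M) M∉T
  K<M : All (_< M) K
  K<M = ≤∧∉⇒< (All.map (λ i → ≤-pred (<-≤-trans i p)) (climb-below K c)) M∉K
  -- A descent before the last M would form a 102 with it.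
  asc : ∀ {x y} → x ∷ y ∷ [] ⊆ K ʳ++ T → x ≤ y
  asc {x} {y} i with All-resp-⊆ i (All-ʳ++ K<M T<M)
  ... | x<M ∷ _ = ≮⇒≥ λ y<x → proj₁ (avoid v xyM) (y<x , x<M)
    where
    xyM : x ∷ y ∷ M ∷ [] ⊆ K ʳ++ (M ∷ (T ++ M ∷ S′))
    xyM = ⊆-trans (Sub.++⁺ i (refl ∷ minimum S′))
      (subst (_⊆ K ʳ++ (M ∷ (T ++ M ∷ S′))) (sym (ʳ++-++ K)) (ʳ++⁺ (⊆-refl {x = K}) (M ∷ʳ ⊆-refl)))

peak-bound : ∀ b z → bound (proj₁ (peak b M z)) ≡ suc M
peak-bound 0      z = refl
peak-bound 1      z = refl
peak-bound (2+ d) z = refl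

record Parent (m t : ℕ) (z : Zipper) : Set where
  constructor parent
  field
    {a₀ b₀ c₀ s₀} : ℕ
    {w} : Zipper
    w-valid    : Valid m s₀ w
    admissible : Admissible s₀ t a₀ b₀ c₀
    z≡         : z ≡ child a₀ b₀ c₀ w

-- After M is deleted, `normalise` extends the prefix by `T`. Hence c = `length T`, and a is the
-- excess of M over the new bound; the length balance of `Admissible` is then read backwards.
parentOf : ∀ z → Valid (suc m) t z → Parent m t z
parentOf {m} {t} z v with unpeaked {b} {M} {R} {S} refl cl R<M S<M b≤ M≤ b>0 ← unpeak z v
  with T , S′ , s , refl , w ← normalise R S cl (<⇒capped S S<M M≤)
    (λ p → avoid v (⊆-trans p (subst (_⊆ unzip z) (filter-peak R<M S<M b) (Sub.filter-⊆ (_<? M) (unzip z))))) =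
  parent {a₀ = a}
    (subst (λ u → Valid u s (T ʳ++ R , S′)) (suc-injective (trans (sym (dist-peak R<M S<M b)) (dist≡ v))) w)
    (+-cancelˡ-≡ N _ _ eq , b>0)
    (sym (cong₂ (peak b) N+a (cong₂ _,_ (drop-ʳ++ T) (take-ʳ++-ʳ++ T))))
  where
  N = bound (T ʳ++ R)
  a = M ∸ N
  N+a : N + a ≡ M
  N+a = m+[n∸m]≡n (bound-≤ (All-ʳ++ (++⁻ˡ T S<M) R<M))
  open ≡-Reasoning
  eq : N + (a + b + length T + t) ≡ N + suc s
  eq = suc-injective (begin
    suc (N + (a + b + length T + t))          ≡⟨ regroup N a b (length T) t ⟩
    suc (N + a + t) + b + length T            ≡⟨ cong (λ u → suc (u + t) + b + length T) N+a ⟩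
    suc M + t + b + length T                  ≡⟨ cong (λ u → u + t + b + length T) (peak-bound b (R , T ++ S′)) ⟨
    bound (proj₁ z) + t + b + length T        ≡⟨ cong (λ u → u + b + length T) (rise v) ⟨
    length (proj₁ z) + b + length T           ≡⟨ cong (_+ length T) (peak-length b b≤) ⟩
    2+ (length R + length T)                  ≡⟨ cong 2+ (+-comm (length R) (length T)) ⟩
    2+ (length T + length R)                  ≡⟨ cong 2+ (length-ʳ++ T) ⟨
    2+ (length (T ʳ++ R))                     ≡⟨ cong 2+ (rise w) ⟩
    2+ (N + s)                                ≡⟨ cong suc (+-suc N s) ⟨
    suc (N + suc s)                           ∎)
    where
    regroup : ∀ N a b c t → suc (N + (a + b + c + t)) ≡ suc (N + a + t) + b + c
    regroup = solve-∀

-- M is the end of the prefix, and deleting it recovers the parent. Then `bound` gives a, the length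
-- of the part after the last M gives c, and the admissibility equation gives b.
child-injective : ∀ {m s s′ t} a b c z a′ b′ c′ z′ → Valid m s z → Valid m s′ z′ →
  Admissible s t a b c → Admissible s′ t a′ b′ c′ → child a b c z ≡ child a′ b′ c′ z′ →
  _≡_ {A = Vec ℕ 3 × Zipper} (a ∷ b ∷ c ∷ [] , z) (a′ ∷ b′ ∷ c′ ∷ [] , z′)
child-injective {m} {s} {s′} {t} a b c z a′ b′ c′ z′ v v′ sp sp′ eq = go z≡ v v′
  where
  module L = Shift v a c (proj₁ (admissible-≤ a b c sp))
  module L′ = Shift v′ a′ c′ (proj₁ (admissible-≤ a′ b′ c′ sp′))
  M≡ : L.M′ ≡ L′.M′
  M≡ = suc-injective (trans (sym (peak-bound b (shift c z)))
         (trans (cong (λ u → bound (proj₁ u)) eq) (peak-bound b′ (shift c′ z′))))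
  z≡ : z ≡ z′
  z≡ = unzip-injective v v′ (begin
    unzip z                                    ≡⟨ L.unzip-shift ⟨
    unzip (shift c z)                          ≡⟨ filter-peak L.R<M L.S<M b ⟨
    filter (_<? L.M′) (unzip (child a b c z))  ≡⟨ cong₂ (λ k u → filter (_<? k) (unzip u)) M≡ eq ⟩
    filter (_<? L′.M′) (unzip (child a′ b′ c′ z′)) ≡⟨ filter-peak L′.R<M L′.S<M b′ ⟩
    unzip (shift c′ z′)                        ≡⟨ L′.unzip-shift ⟩
    unzip z′                                   ∎)
    where open ≡-Reasoning
  S≡ : L.S′ ≡ L′.S′
  S≡ = peak-suffix L.R<M L.S<M b {b′} {L′.R′} (subst (λ k → All (_< k) L′.S′) (sym M≡) L′.S<M)
    (trans (cong unzip eq) (trans (peak-left b′) (cong (λ k → left b′ k L′.R′ ʳ++ (k ∷ L′.S′)) (sym M≡))))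
  go : z ≡ z′ → Valid m s z → Valid m s′ z′ →
    _≡_ {A = Vec ℕ 3 × Zipper} (a ∷ b ∷ c ∷ [] , z) (a′ ∷ b′ ∷ c′ ∷ [] , z′)
  go refl v v′ = tuple a≡ b≡ c≡
    where
    tuple : a ≡ a′ → b ≡ b′ → c ≡ c′ → _≡_ {A = Vec ℕ 3 × Zipper} (a ∷ b ∷ c ∷ [] , z) (a′ ∷ b′ ∷ c′ ∷ [] , z′)
    tuple refl refl refl = refl
    s≡ : s ≡ s′
    s≡ = +-cancelˡ-≡ (bound (proj₁ z)) _ _ (trans (sym (rise v)) (rise v′))
    a≡ : a ≡ a′
    a≡ = +-cancelˡ-≡ (bound (proj₁ z)) _ _ M≡
    c≡ : c ≡ c′
    c≡ = +-cancelʳ-≡ (length (proj₂ z)) _ _ (trans (sym L.length-S) (trans (cong length S≡) L′.length-S))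
    b≡ : b ≡ b′
    b≡ = +-cancelˡ-≡ a _ _ (+-cancelʳ-≡ c _ _ (+-cancelʳ-≡ t _ _
      (trans (proj₁ sp) (trans (cong suc s≡) (trans (sym (proj₁ sp′))
        (cong₂ (λ p q → p + b′ + q + t) (sym a≡) (sym c≡)))))))

-- Counting zippers, and passing to positions

dist≡0 : ∀ e → dist e ≡ 0 → e ≡ []
dist≡0 []      _  = refl
dist≡0 (x ∷ e) eq with x ∈? e
dist≡0 (x ∷ e) eq | yes x∈e with refl ← dist≡0 e eq with () ← x∈e

ʳ++≡[] : ∀ R {S : List ℕ} → R ʳ++ S ≡ [] → (R , S) ≡ ([] , [])
ʳ++≡[] []      refl = refl
ʳ++≡[] (x ∷ R) {S} eq with () ← trans (sym (+-suc (length R) (length S)))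
  (trans (sym (length-ʳ++ R)) (cong length eq))

valid-0 : ∀ {t} z → Valid 0 t z → z ≡ ([] , []) × t ≡ 0
valid-0 z v with refl ← ʳ++≡[] (proj₁ z) (dist≡0 (unzip z) (dist≡ v)) = refl , sym (rise v)

-- Each insertion raises the rank by at most one and `dist` by exactly one.
rank≤dist : ∀ m t z → m < t → ¬ Valid m t z
rank≤dist zero    t z m<t v = <⇒≢ m<t (sym (proj₂ (valid-0 z v)))
rank≤dist (suc m) t z m<t v with parent {a} {b} {c} {s} {w} w-valid (eq , _) _ ← parentOf z v =
  rank≤dist m s w (≤-pred (<-≤-trans m<t (≤-trans (m≤n+m t (a + b + c)) (≤-reflexive eq)))) w-valid

-- Admissibility gives the parent rank a + b + c + (t - 1) when t ≥ 1, three slacks over t - 1. When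
-- t = 0, b ≥ 1 is replaced by b - 1, giving three slacks over 0.
count-valid : ∀ m n t → n + t ≡ m → Count (Valid m t) (raney n (3 * t + 1))
count-valid zero zero zero refl =
  count-cong (λ { _ refl → valid tt refl [] tt (λ ()) refl }) (λ z v → proj₁ (valid-0 z v))
    (count-≡ ([] , []))
count-valid (suc m) zero zero ()
count-valid (suc m) (suc n) zero eq =
  count-cong
    (λ { _ ((a ∷ b ∷ c ∷ [] , z) , v , refl) → child-valid a (suc b) c v (admissible₀ a b c) })
    split₀
    (count-map f
      (λ { (a ∷ b ∷ c ∷ [] , z) (a′ ∷ b′ ∷ c′ ∷ [] , z′) v v′ eq →
        cong (λ { (a ∷ b ∷ c ∷ [] , z) → a ∷ pred b ∷ c ∷ [] , z })
          (child-injective a (suc b) c z a′ (suc b′) c′ z′ v v′ (admissible₀ a b c) (admissible₀ a′ b′ c′) eq) })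
      -- The count is `raney n 4`, to which `raney (suc n) 1` unfolds.
      (count-slack (Valid m) m (count-valid m) (rank≤dist m) 3 n 0 (suc-injective eq)))
  where
  f : Vec ℕ 3 × Zipper → Zipper
  f (a ∷ b ∷ c ∷ [] , z) = child a (suc b) c z
  ring₀ : ∀ a b c → a + suc b + c + 0 ≡ suc (a + (b + (c + 0)) + 0)
  ring₀ = solve-∀
  admissible₀ : ∀ a b c → Admissible (a + (b + (c + 0)) + 0) 0 a (suc b) c
  admissible₀ a b c = ring₀ a b c , λ _ → s≤s z≤n
  split₀ : ∀ z → Valid (suc m) 0 z → ∃ λ x → Slack (Valid m) 3 0 x × z ≡ f x
  split₀ z v with parentOf z v
  ... | parent {b₀ = zero} _ (_ , b>0) _ with () ← b>0 refl
  ... | parent {a} {suc b} {c} {s} {w} w-valid (eq , _) z≡ =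
    (a ∷ b ∷ c ∷ [] , w) ,
    subst (λ u → Valid m u w) (suc-injective (trans (sym eq) (ring₀ a b c))) w-valid , z≡
count-valid (suc m) n (suc t) eq =
  subst (Count _) (cong (raney n) (ring t))
  (count-cong
    (λ { _ ((a ∷ b ∷ c ∷ [] , z) , v , refl) → child-valid a b c v (admissible₁ a b c) })
    split₁
    (count-map f
      (λ { (a ∷ b ∷ c ∷ [] , z) (a′ ∷ b′ ∷ c′ ∷ [] , z′) v v′ eq →
        child-injective a b c z a′ b′ c′ z′ v v′ (admissible₁ a b c) (admissible₁ a′ b′ c′) eq })
      (count-slack (Valid m) m (count-valid m) (rank≤dist m) 3 n t (suc-injective (trans (sym (+-suc n t)) eq)))))
  where
  f : Vec ℕ 3 × Zipper → Zipper
  f (a ∷ b ∷ c ∷ [] , z) = child a b c z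
  ring : ∀ t → 3 + (3 * t + 1) ≡ 3 * suc t + 1
  ring = solve-∀
  ring₁ : ∀ a b c t → a + b + c + suc t ≡ suc (a + (b + (c + 0)) + t)
  ring₁ = solve-∀
  admissible₁ : ∀ a b c → Admissible (a + (b + (c + 0)) + t) (suc t) a b c
  admissible₁ a b c = ring₁ a b c t , λ ()
  split₁ : ∀ z → Valid (suc m) (suc t) z → ∃ λ x → Slack (Valid m) 3 t x × z ≡ f x
  split₁ z v with parent {a} {b} {c} {s} {w} w-valid (eq , _) z≡ ← parentOf z v =
    (a ∷ b ∷ c ∷ [] , w) ,
    subst (λ u → Valid m u w) (suc-injective (trans (sym eq) (ring₁ a b c t))) w-valid , z≡

capped⇒inv : ∀ k e → Capped k e → ∀ i → lookup e i ≤ k + toℕ i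
capped⇒inv k (x ∷ e) (p , _) zero    = ≤-trans p (m≤m+n k 0)
capped⇒inv k (x ∷ e) (_ , c) (suc i) =
  ≤-trans (capped⇒inv (suc k) e c i) (≤-reflexive (sym (+-suc k (toℕ i))))

inv⇒capped : ∀ k e → (∀ i → lookup e i ≤ k + toℕ i) → Capped k e
inv⇒capped k []      p = tt
inv⇒capped k (x ∷ e) p = subst (x ≤_) (+-identityʳ k) (p zero) ,
  inv⇒capped (suc k) e λ i → ≤-trans (p (suc i)) (≤-reflexive (+-suc k (toℕ i)))

module _ {A : Set} where

  embed : {xs ys : List A} → xs ⊆ ys → Fin (length xs) → Fin (length ys)
  embed (y ∷ʳ p)  i       = suc (embed p i)
  embed (refl ∷ p) zero    = zero
  embed (refl ∷ p) (suc i) = suc (embed p i)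

  embed-mono : {xs ys : List A} (p : xs ⊆ ys) {i j : Fin (length xs)} →
               i Fin.< j → embed p i Fin.< embed p j
  embed-mono (y ∷ʳ p)  i<j = s<s (embed-mono p i<j)
  embed-mono (refl ∷ p) {zero}  {suc j} _         = z<s
  embed-mono (refl ∷ p) {suc i} {suc j} (s≤s i<j) = s<s (embed-mono p i<j)

  lookup-embed : {xs ys : List A} (p : xs ⊆ ys) (i : Fin (length xs)) →
                 lookup ys (embed p i) ≡ lookup xs i
  lookup-embed (y ∷ʳ p)  i       = lookup-embed p i
  lookup-embed (refl ∷ p) zero    = refl
  lookup-embed (refl ∷ p) (suc i) = lookup-embed p i

  pair-⊆ : (xs : List A) (i j : Fin (length xs)) → i Fin.< j →
           lookup xs i ∷ lookup xs j ∷ [] ⊆ xs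
  pair-⊆ (x ∷ xs) zero    (suc j) _         = refl ∷ from∈ (∈-lookup j)
  pair-⊆ (x ∷ xs) (suc i) (suc j) (s≤s i<j) = x ∷ʳ pair-⊆ xs i j i<j

  triple-⊆ : (xs : List A) (i j k : Fin (length xs)) → i Fin.< j → j Fin.< k →
             lookup xs i ∷ lookup xs j ∷ lookup xs k ∷ [] ⊆ xs
  triple-⊆ (x ∷ xs) zero    (suc j) (suc k) _         (s≤s j<k) = refl ∷ pair-⊆ xs j k j<k
  triple-⊆ (x ∷ xs) (suc i) (suc j) (suc k) (s≤s i<j) (s≤s j<k) = x ∷ʳ triple-⊆ xs i j k i<j j<k

avoid⇒ : ∀ e → Avoid e → Avoids102-000 e
avoid⇒ e av i j k i<j j<k = av (triple-⊆ e i j k i<j j<k)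

⇒avoid : ∀ e → Avoids102-000 e → Avoid e
⇒avoid e av p with av (embed p zero) (embed p (suc zero)) (embed p (suc (suc zero)))
                     (embed-mono p z<s) (embed-mono p (s<s z<s))
... | q rewrite lookup-embed p zero | lookup-embed p (suc zero) | lookup-embed p (suc (suc zero)) = q

-- The state of the computation of `rank` once the prefix has been read.
rankTail : List ℕ → List ℕ → ℤ.ℤ
rankTail []      S = rank S
rankTail (x ∷ R) S = rankFrom (suc (length R)) x S

rank-ʳ++ : ∀ R S → Climb R → rank (R ʳ++ S) ≡ rankTail R S
rank-ʳ++ []          S _           = refl
rank-ʳ++ (x ∷ [])    S _           = refl
rank-ʳ++ (x ∷ w ∷ R) S (p , _ , c) with eq ← rank-ʳ++ (w ∷ R) (x ∷ S) c | w ≤? x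
... | yes _ = eq
... | no ¬p = contradiction (≤-pred p) ¬p

rank-valid : ∀ {m t} z → Valid m t z → rank (unzip z) ≡ + t
rank-valid {t = t} (R , S) v = trans (rank-ʳ++ R S (climb v)) (go R S (rise v) (falls v))
  where
  pos-minus : ∀ x n → n ≡ x + t → (+ suc n ℤ.- + 1) ℤ.- + x ≡ + t
  pos-minus x _ refl = trans (ℤ.m-n≡m⊖n (x + t) x) (trans (ℤ.⊖-≥ (m≤m+n x t)) (cong +_ (m+n∸m≡n x t)))
  go : ∀ R S → length R ≡ bound R + t → Falls (bound R) S → rankTail R S ≡ + t
  go []      []      refl _  = refl
  go (x ∷ R) []      eq   _  = pos-minus x (length R) (suc-injective eq)
  go (x ∷ R) (y ∷ S) eq   f with x ≤? y
  ... | yes p = contradiction p (<⇒≱ (≤-pred f))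
  ... | no  _ = pos-minus x (length R) (suc-injective eq)

capped-ʳ++ : ∀ R S → Climb R → Capped (length R) S → Capped 0 (R ʳ++ S)
capped-ʳ++ []      S _           cap = cap
capped-ʳ++ (x ∷ R) S (_ , p , c) cap = capped-ʳ++ R (x ∷ S) c (p , cap)

Counted : ℕ → ℕ → List ℕ → Set
Counted m t e = IsInvSeq e × Avoids102-000 e × dist e ≡ m × rank e ≡ + t

valid⇒counted : ∀ {m t} z → Valid m t z → Counted m t (unzip z)
valid⇒counted (R , S) v =
  capped⇒inv 0 _ (capped-ʳ++ R S (climb v)
    (<⇒capped S (below v) (m≤n⇒m≤1+n (climb-bound R (climb v))))) ,
  avoid⇒ _ (avoid v) , dist≡ v , rank-valid (R , S) v

-- Normalising from the empty prefix produces some rank s, and comparison with `rank e` identifies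
-- it with t.
counted⇒valid : ∀ {m t} e → Counted m t e → ∃ λ z → Valid m t z × e ≡ unzip z
counted⇒valid {m} {t} e (inv , av , refl , rk)
  with T , S , s , refl , v ← normalise [] e tt (inv⇒capped 0 e inv) (⇒avoid e av) =
  (T ʳ++ [] , S) , subst (λ u → Valid m u (T ʳ++ [] , S)) s≡t v , e≡
  where
  e≡ : T ++ S ≡ (T ʳ++ []) ʳ++ S
  e≡ = sym (ʳ++-ʳ++ T)
  s≡t : s ≡ t
  s≡t = ℤ.+-injective (trans (sym (rank-valid (T ʳ++ [] , S) v)) (trans (cong rank (sym e≡)) rk))

theorem4p4 : (m t : ℕ) → t ≤ m →
    Σ (List (List ℕ)) (λ L →
    Unique L
    × ((e : List ℕ) → (e ∈ L) ⇔ (IsInvSeq e × Avoids102-000 e × dist e ≡ m × rank e ≡ + t))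
    × (3 * m + 1) * length L ≡ (3 * t + 1) * ((4 * m ∸ t) C (m ∸ t)))
theorem4p4 m t t≤m
  with L , unique , complete , len ← count-cong
         (λ { _ (z , v , refl) → valid⇒counted z v }) counted⇒valid
         (count-map unzip (λ _ _ → unzip-injective) (count-valid m (m ∸ t) t (m∸n+n≡m t≤m))) =
  L , unique , complete , (begin
    (3 * m + 1) * length L                        ≡⟨ cong ((3 * m + 1) *_) len ⟩
    (3 * m + 1) * raney n (3 * t + 1)             ≡⟨ cong (λ u → (3 * u + 1) * raney n (3 * t + 1)) (m∸n+n≡m t≤m) ⟨
    (3 * (n + t) + 1) * raney n (3 * t + 1)       ≡⟨ raney-closed n t ⟩
    (3 * t + 1) * ((4 * n + 3 * t) C n)           ≡⟨ cong (λ u → (3 * t + 1) * (u C n)) top ⟩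
    (3 * t + 1) * ((4 * m ∸ t) C n)               ∎)
  where
  open ≡-Reasoning
  n = m ∸ t
  ring : ∀ n t → 4 * (n + t) ≡ 4 * n + 3 * t + t
  ring = solve-∀
  top : 4 * n + 3 * t ≡ 4 * m ∸ t
  top = sym (trans (cong (_∸ t) (trans (cong (4 *_) (sym (m∸n+n≡m t≤m))) (ring n t))) (m+n∸n≡m _ t))
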